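{- Let $v=2m$ or $v=2m+1$ with $m\geq 2$, and let $1\leq k<m$. Let $1\leq z_1\leq k$ and $1\leq z_2\leq m$, and let $L=(L^*\setminus\{k,k+1\})\cup\{z_1,z_2\}$ (multiset operations: remove one copy of $k$ and one copy of $k+1$, add $z_1$ and $z_2$). Then $\mathrm{BHR}(L)$ holds; in particular there exists a Hamiltonian path $H$ of $K_v$ with $\ell(H)=L$.
   Context: $K_v$ is the complete graph on vertex set $\{0,1,\ldots,v-1\}$; the length of an edge $[x,y]$ is $\min(|x-y|,v-|x-y|)$ and $\ell(H)$ is the multiset of edge lengths of $H$. If $v=2m+1$, $L^*=\{1^2,2^2,\ldots,m^2\}$; if $v=2m$, $L^*=\{1^2,2^2,\ldots,(m-1)^2,m^1\}$, where $i^{a}$ denotes $a$ copies of $i$. For a list $L$ of $v-1$ positive integers not exceeding $\lfloor v/2\rfloor$, $\mathrm{BHR}(L)$ is the statement: there exists a Hamiltonian path $H$ of $K_v$ with $\ell(H)=L$ if and only if for every divisor $d$ of $v$ the number of elements of $L$ (with multiplicity) that are multiples of $d$ is at most $v-d$. -}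

module Defs where

open import Data.Nat using (ℕ; zero; suc; _+_; _*_; _∸_; _≤_; _<_; ∣_-_∣; _⊓_; _/_; _≟_)
open import Data.Nat.Divisibility using (_∣_; _∣?_)
open import Data.Fin using (Fin; toℕ)
open import Data.List using (List; []; _∷_; length; filter; concatMap; map; upTo)
open import Data.List.Relation.Unary.Unique.Propositional using (Unique)
open import Data.List.Relation.Binary.Permutation.Propositional using (_↭_)
open import Data.Product using (Σ; ∃; _×_)
open import Relation.Binary.PropositionalEquality using (_≡_)
open import Relation.Nullary using (yes; no)
open import Function.Bundles using (_⇔_)

edgeLen : (v : ℕ) → ℕ → ℕ → ℕ
edgeLen v x y = ∣ x - y ∣ ⊓ (v ∸ ∣ x - y ∣)

record HamPath (v : ℕ) : Set where
  constructor hampath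
  field
    verts    : List (Fin v)
    distinct : Unique verts
    spanning : length verts ≡ v

edgeLens : (v : ℕ) → List (Fin v) → List ℕ
edgeLens v []           = []
edgeLens v (x ∷ [])     = []
edgeLens v (x ∷ y ∷ xs) = edgeLen v (toℕ x) (toℕ y) ∷ edgeLens v (y ∷ xs)

-- ℓ(H) as a list (compared as multisets via _↭_)
ℓ : {v : ℕ} → HamPath v → List ℕ
ℓ {v} H = edgeLens v (HamPath.verts H)

Lstar : ℕ → List ℕ
Lstar v = concatMap copies (map suc (upTo (v / 2)))
  where
  copies : ℕ → List ℕ
  copies i with 2 * i ≟ v
  ... | yes _ = i ∷ []
  ... | no  _ = i ∷ i ∷ []

removeOne : ℕ → List ℕ → List ℕ
removeOne x [] = []
removeOne x (y ∷ ys) with x ≟ y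
... | yes _ = ys
... | no  _ = y ∷ removeOne x ys

countMultiples : ℕ → List ℕ → ℕ
countMultiples d L = length (filter (d ∣?_) L)

BHR : (v : ℕ) → List ℕ → Set
BHR v L = (∃ λ (H : HamPath v) → ℓ H ↭ L)
        ⇔ (∀ d → d ∣ v → countMultiples d L ≤ v ∸ d)

Lk : (v k z₁ z₂ : ℕ) → List ℕ
Lk v k z₁ z₂ = z₁ ∷ z₂ ∷ removeOne k (removeOne (suc k) (Lstar v))

{-# OPTIONS --safe #-}
module Submission where

-- Every path has a graceful labelling with any prescribed label at its first
-- vertex. Label one path gracefully by 1, …, k starting from z₁, and another by
-- -1, …, -(v-k-1) modulo v starting from -z₂, and join the two first vertices to
-- the vertex 0. The joining edges have lengths z₁ and z₂; the others have the
-- lengths of the differences 1, …, k-1 and 1, …, v-k-2. Since L* consists of the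
-- lengths of 1, …, v-1, and those of v-k-1, …, v-1 are k+1, k, …, 1, the path
-- misses exactly one k and one k+1. Divisibility is necessary for any
-- Hamiltonian path, since it has to visit all residue classes modulo d.

open import Defs
open import Data.Nat
open import Data.Nat.Properties
open import Data.Nat.DivMod using (_%_; m<n⇒m%n≡m; m*n/n≡m; +-distrib-/-∣ˡ; %-remove-+ʳ)
open import Data.Nat.Divisibility using (_∣_; _∣?_; ∣m+n∣m⇒∣n; 0∣⇒≡0; divides-refl; ∣⇒≤)
open import Data.Nat.Tactic.RingSolver using (solve-∀)
open import Data.Fin as Fin using (Fin; toℕ; fromℕ<)
open import Data.Fin.Properties using (toℕ<n; toℕ-fromℕ<)
open import Data.List
  using (List; []; _∷_; _++_; _ʳ++_; [_]; map; concatMap; length; upTo; downFrom; allFin; applyUpTo)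
open import Data.List.Properties
  using (map-++; map-id; map-cong; map-∘; concatMap-++; length-upTo; length-tabulate; length-map; ++-assoc)
open import Data.List.Relation.Unary.All as All using (All; []; _∷_)
import Data.List.Relation.Unary.All.Properties as All
open import Data.List.Relation.Unary.Any using (here; there)
open import Data.List.Relation.Unary.AllPairs using (_∷_)
open import Data.List.Relation.Unary.Unique.Propositional using (Unique)
import Data.List.Relation.Unary.Unique.Propositional.Properties as Unique
open import Data.List.Membership.Propositional using (_∈_)
open import Data.List.Membership.Propositional.Properties using (∈-∃++; ∈-allFin; ∈-upTo⁻)
import Data.List.Membership.DecPropositional as DecMembership
open import Data.List.Relation.Binary.Permutation.Propositional
  using (_↭_; ↭-refl; ↭-prep; ↭-swap; ↭-sym; ↭-trans; ↭-reflexive; ↭⇒↭ₛ; module PermutationReasoning)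
open import Data.List.Relation.Binary.Permutation.Propositional.Properties
  using (All-resp-↭; ∈-resp-↭; map⁺; ↭-length; ++⁺; ++⁺ˡ; ++⁺ʳ; ++-comm; shift; shifts; drop-∷;
         ∷↭∷ʳ; ++↭ʳ++; filter-↭)
import Data.List.Relation.Binary.Permutation.Setoid.Properties as SetoidPermutation
open import Data.Product using (_,_; proj₁; proj₂; ∃; _×_)
open import Data.Sum using (_⊎_; inj₁; inj₂)
open import Data.Unit using (⊤)
open import Function using (id; _∘_; mk⇔)
open import Relation.Nullary using (yes; no; contradiction)
open import Relation.Binary.PropositionalEquality
  using (_≡_; _≢_; refl; sym; trans; cong; cong₂; subst; subst₂; setoid; module ≡-Reasoning)

-- Runs of consecutive integers

interval : ℕ → ℕ → List ℕ
interval a zero    = []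
interval a (suc n) = a ∷ interval (suc a) n

interval-++ : ∀ {a b} m n → a + m ≡ b → interval a m ++ interval b n ≡ interval a (m + n)
interval-++ {a} zero    n refl = cong (λ x → interval x n) (+-identityʳ a)
interval-++ {a} (suc m) n refl = cong (a ∷_) (interval-++ m n (sym (+-suc a m)))

map-+-interval : ∀ c a n → map (c +_) (interval a n) ≡ interval (c + a) n
map-+-interval c a zero    = refl
map-+-interval c a (suc n) = cong (c + a ∷_)
  (trans (map-+-interval c (suc a) n) (cong (λ x → interval x n) (+-suc c a)))

∷-interval : ∀ a n → a + n ∷ interval a n ↭ interval a (suc n)
∷-interval a n = begin
  a + n ∷ interval a n                 ↭⟨ ∷↭∷ʳ (a + n) (interval a n) ⟩
  interval a n ++ interval (a + n) 1   ≡⟨ interval-++ n 1 refl ⟩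
  interval a (n + 1)                   ≡⟨ cong (interval a) (+-comm n 1) ⟩
  interval a (suc n)                   ∎
  where open PermutationReasoning

-- The equation in the hypothesis says, without subtraction, that `x` is the image `N ∸ (a + n ∸ 1)`
-- of the last entry, hence the least of the reflected values. It also keeps every subtraction from
-- being cut off at 0.
reflect-interval : ∀ {N} a n x → a + n + x ≡ suc N → map (N ∸_) (interval a n) ↭ interval x n
reflect-interval a zero    x e = ↭-refl
reflect-interval {N} a (suc n) x e = begin
  N ∸ a ∷ map (N ∸_) (interval (suc a) n)
    ↭⟨ ↭-prep _ (reflect-interval (suc a) n x (trans (cong (_+ x) (sym (+-suc a n))) e)) ⟩
  N ∸ a ∷ interval x n
    ≡⟨ cong (_∷ interval x n) (trans (cong (_∸ a) N≡) (m+n∸m≡n a (x + n))) ⟩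
  x + n ∷ interval x n   ↭⟨ ∷-interval x n ⟩
  interval x (suc n)     ∎
  where
  open PermutationReasoning
  rearrange : ∀ a n x → a + suc n + x ≡ suc (a + (x + n))
  rearrange = solve-∀
  N≡ : N ≡ a + (x + n)
  N≡ = suc-injective (trans (sym e) (rearrange a n x))

downFrom-interval : ∀ n → downFrom n ↭ interval 0 n
downFrom-interval zero    = ↭-refl
downFrom-interval (suc n) = ↭-trans (↭-prep n (downFrom-interval n)) (∷-interval 0 n)

interval-< : ∀ a n → All (_< a + n) (interval a n)
interval-< a zero    = []
interval-< a (suc n) = m<m+n a z<s
                     ∷ subst (λ x → All (_< x) (interval (suc a) n)) (sym (+-suc a n)) (interval-< (suc a) n)

below : ∀ {n xs} → xs ↭ interval 0 n → All (_< n) xs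
below {n} p = All-resp-↭ (↭-sym p) (interval-< 0 n)

below-suc : ∀ {n xs} → xs ↭ interval 0 (suc n) → All (_≤ n) xs
below-suc p = All.map s≤s⁻¹ (below p)

map-cong-All : ∀ {P : ℕ → Set} {f g : ℕ → ℕ} → (∀ {x} → P x → f x ≡ g x) →
               ∀ {xs} → All P xs → map f xs ≡ map g xs
map-cong-All eq []       = refl
map-cong-All eq (p ∷ ps) = cong₂ _∷_ (eq p) (map-cong-All eq ps)

-- Alternating lists, and sums and differences of neighbours

odds evens : List ℕ → List ℕ
odds []       = []
odds (x ∷ xs) = x ∷ evens xs
evens []       = []
evens (x ∷ xs) = odds xs

alternate : (f g : ℕ → ℕ) → List ℕ → List ℕ
alternate f g []       = []
alternate f g (x ∷ xs) = f x ∷ alternate g f xs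

odds-alternate : ∀ f g xs → odds (alternate f g xs) ≡ map f (odds xs)
evens-alternate : ∀ f g xs → evens (alternate f g xs) ≡ map g (evens xs)
odds-alternate f g []       = refl
odds-alternate f g (x ∷ xs) = cong (f x ∷_) (evens-alternate g f xs)
evens-alternate f g []       = refl
evens-alternate f g (x ∷ xs) = odds-alternate g f xs

alternate-↭ : ∀ f g xs → alternate f g xs ↭ map f (odds xs) ++ map g (evens xs)
alternate-↭ f g []       = ↭-refl
alternate-↭ f g (x ∷ xs) = ↭-prep (f x)
  (↭-trans (alternate-↭ g f xs) (++-comm (map g (odds xs)) (map f (evens xs))))

consec : (ℕ → ℕ → ℕ) → List ℕ → List ℕ
consec _∙_ []           = []
consec _∙_ (x ∷ [])     = []
consec _∙_ (x ∷ y ∷ xs) = (x ∙ y) ∷ consec _∙_ (y ∷ xs)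

sums diffs : List ℕ → List ℕ
sums  = consec _+_
diffs = consec ∣_-_∣

-- The roles of `f`, `P` and `g`, `Q` are exchanged at each step along the list, which is why the
-- hypothesis comes in two orders. `P` and `Q` carry the bounds under which truncated subtraction is
-- exact.
consec-alternate : ∀ {_∙_ _∘_ : ℕ → ℕ → ℕ} {f g h : ℕ → ℕ} {P Q : ℕ → Set} →
  (∀ {a b} → P a → Q b → f a ∙ g b ≡ h (a ∘ b)) →
  (∀ {a b} → Q b → P a → g b ∙ f a ≡ h (b ∘ a)) →
  ∀ xs → All P (odds xs) → All Q (evens xs) →
  consec _∙_ (alternate f g xs) ≡ map h (consec _∘_ xs)
consec-alternate fg gf []           _        _        = refl
consec-alternate fg gf (x ∷ [])     _        _        = refl
consec-alternate {f = f} {g} {P = P} {Q} fg gf (x ∷ y ∷ xs) (p ∷ ps) (q ∷ qs) =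
  cong₂ _∷_ (fg p q) (consec-alternate {f = g} {f} {P = Q} {P} gf fg (y ∷ xs) (q ∷ qs) ps)

consec-map : ∀ {_∙_ _∘_ : ℕ → ℕ → ℕ} {f h : ℕ → ℕ} {P : ℕ → Set} →
  (∀ {x y} → P x → P y → f x ∙ f y ≡ h (x ∘ y)) →
  ∀ {xs} → All P xs → consec _∙_ (map f xs) ≡ map h (consec _∘_ xs)
consec-map eq []           = refl
consec-map eq (p ∷ [])     = refl
consec-map eq (p ∷ q ∷ ps) = cong₂ _∷_ (eq p q) (consec-map eq (q ∷ ps))

sums-alternate-+ : ∀ a b xs → sums (alternate (a +_) (b +_) xs) ≡ map (a + b +_) (sums xs)
sums-alternate-+ a b xs = consec-alternate {P = λ _ → ⊤} {Q = λ _ → ⊤}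
  (λ {x} {y} _ _ → arith₁ a b x y) (λ {x} {y} _ _ → arith₂ a b x y) xs (All.universal _ _) (All.universal _ _)
  where
  arith₁ : ∀ a b x y → (a + x) + (b + y) ≡ (a + b) + (x + y)
  arith₁ = solve-∀
  arith₂ : ∀ a b x y → (b + y) + (a + x) ≡ (a + b) + (y + x)
  arith₂ = solve-∀

∸-+-∸ : ∀ {A B a b} → a ≤ A → b ≤ B → (A ∸ a) + (B ∸ b) ≡ (A + B) ∸ (a + b)
∸-+-∸ {A} {B} {a} {b} a≤A b≤B with m≤n⇒∃[o]m+o≡n a≤A | m≤n⇒∃[o]m+o≡n b≤B
... | c , refl | d , refl = trans (cong₂ _+_ (m+n∸m≡n a c) (m+n∸m≡n b d))
  (sym (trans (cong (_∸ (a + b)) (arith a b c d)) (m+n∸m≡n (a + b) (c + d))))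
  where
  arith : ∀ a b c d → (a + c) + (b + d) ≡ (a + b) + (c + d)
  arith = solve-∀

sums-alternate-∸ : ∀ A B xs → All (_≤ A) (odds xs) → All (_≤ B) (evens xs) →
                   sums (alternate (A ∸_) (B ∸_) xs) ≡ map (A + B ∸_) (sums xs)
sums-alternate-∸ A B = consec-alternate
  (λ a≤A b≤B → ∸-+-∸ a≤A b≤B)
  (λ {a} {b} b≤B a≤A → trans (∸-+-∸ b≤B a≤A) (cong (_∸ (b + a)) (+-comm B A)))

∣-∸∣ : ∀ {N a b} → b ≤ N → ∣ a - (N ∸ b) ∣ ≡ ∣ N - (a + b) ∣
∣-∸∣ {N} {a} {b} b≤N with m≤n⇒∃[o]m+o≡n b≤N
... | c , refl = trans (cong (∣ a -_∣) (m+n∸m≡n b c))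
  (sym (trans (∣-∣-comm (b + c) (a + b))
       (trans (cong (∣_- b + c ∣) (+-comm a b)) (∣m+n-m+o∣≡∣n-o∣ b a c))))

-- A label `a` next to a label `N ∸ b` differs from it by `∣ N - (a + b) ∣`, so differences of
-- labels are governed by sums of codes. The absolute value stays because `middle-graceful` has sums
-- on both sides of `N`.
diffs-alternate-∸ : ∀ N xs → All (_≤ N) (evens xs) → diffs (alternate id (N ∸_) xs) ≡ map ∣ N -_∣ (sums xs)
diffs-alternate-∸ N xs = consec-alternate {f = id} {P = λ _ → ⊤}
  (λ _ b≤N → ∣-∸∣ b≤N)
  (λ {a} {b} b≤N _ → trans (∣-∣-comm (N ∸ b) a) (trans (∣-∸∣ b≤N) (cong (∣ N -_∣) (+-comm a b))))
  xs (All.universal _ _)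

∣∸-∸∣ : ∀ {N a b} → a ≤ N → b ≤ N → ∣ N ∸ a - (N ∸ b) ∣ ≡ ∣ a - b ∣
∣∸-∸∣ {N} {a} {b} a≤N b≤N with m≤n⇒∃[o]m+o≡n a≤N
... | c , refl = trans (∣-∸∣ b≤N) (trans (cong (λ x → ∣ a + c - (x + b) ∣) (m+n∸m≡n a c))
   (trans (cong (∣_- c + b ∣) (+-comm a c)) (∣m+n-m+o∣≡∣n-o∣ c a b)))

-- Zigzags: encoded α-labellings of paths with a given first label

-- An α-labelling of the path with p + q vertices, in which the i-th low label
-- is written i and the i-th label from the top is written i as well; low and
-- high labels alternate along the path. Labels a and b at the two ends of an
-- edge then differ by p + q ∸ 1 ∸ (a + b).
record Zigzag (p q i : ℕ) : Set where
  constructor zigzag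
  field
    tail   : List ℕ
    odds↭  : odds (i ∷ tail) ↭ interval 0 p
    evens↭ : evens (i ∷ tail) ↭ interval 0 q
    sums↭  : sums (i ∷ tail) ↭ interval 0 (pred (p + q))

single : Zigzag 1 0 0
single = zigzag [] ↭-refl ↭-refl ↭-refl

reflect-all : ∀ {N xs} → xs ↭ interval 0 (suc N) → map (N ∸_) xs ↭ interval 0 (suc N)
reflect-all {N} p = ↭-trans (map⁺ _ p) (reflect-interval 0 (suc N) 0 (+-identityʳ _))

-- Reflecting the low codes in `P` and the high codes in `Q` turns a sum `s` into `P + Q ∸ s`, and
-- the sums fill 0, ..., P + Q.
invert : ∀ {P Q i} → Zigzag (suc P) (suc Q) i → Zigzag (suc P) (suc Q) (P ∸ i)
invert {P} {Q} {i} (zigzag t o e s) = zigzag (alternate (Q ∸_) (P ∸_) t)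
  (↭-trans (↭-reflexive (odds-alternate (P ∸_) (Q ∸_) (i ∷ t))) (reflect-all o))
  (↭-trans (↭-reflexive (evens-alternate (P ∸_) (Q ∸_) (i ∷ t))) (reflect-all e))
  (↭-trans (↭-reflexive (sums-alternate-∸ P Q (i ∷ t) (below-suc o) (below-suc e)))
    (subst (λ n → map (P + Q ∸_) (sums (i ∷ t)) ↭ interval 0 n) (sym (+-suc P Q))
      (reflect-all (subst (λ n → sums (i ∷ t) ↭ interval 0 n) (+-suc P Q) s))))

-- i ∷ stair i xs = i, i-1, i-1, ..., 1, 1, 0, 0 followed by xs
stair : ℕ → List ℕ → List ℕ
stair zero    xs = xs
stair (suc i) xs = i ∷ i ∷ stair i xs

odds-stair : ∀ i xs → odds (stair i xs) ≡ downFrom i ++ odds xs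
odds-stair zero    xs = refl
odds-stair (suc i) xs = cong (i ∷_) (odds-stair i xs)

evens-stair : ∀ i xs → evens (stair i xs) ≡ downFrom i ++ evens xs
evens-stair zero    xs = refl
evens-stair (suc i) xs = cong (i ∷_) (evens-stair i xs)

-- The stair has each sum below 2i exactly once, and since it ends in 0 the sum at the junction is
-- `x` itself.
sums-stair : ∀ i x xs → sums (i ∷ stair i (x ∷ xs)) ≡ downFrom (i + i) ++ x ∷ sums (x ∷ xs)
sums-stair zero    x xs = refl
sums-stair (suc i) x xs rewrite +-suc i i = cong (λ l → suc (i + i) ∷ i + i ∷ l) (sums-stair i x xs)

downFrom-++-shift : ∀ m {n xs} → xs ↭ interval 0 n → downFrom m ++ map (m +_) xs ↭ interval 0 (m + n)
downFrom-++-shift m {n} {xs} p = begin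
  downFrom m ++ map (m +_) xs              ↭⟨ ++⁺ (downFrom-interval m) (map⁺ (m +_) p) ⟩
  interval 0 m ++ map (m +_) (interval 0 n) ≡⟨ cong (interval 0 m ++_) (map-+-interval m 0 n) ⟩
  interval 0 m ++ interval (m + 0) n        ≡⟨ interval-++ m n (sym (+-identityʳ m)) ⟩
  interval 0 (m + n)                        ∎
  where open PermutationReasoning

-- The prefix i, i-1, i-1, ..., 0, 0 has odd length, so the old zigzag continues with low and high
-- exchanged. Its codes move up by `i` and `suc i`, past those of the prefix, and its sums by 2i +
-- 1. The junction supplies the sum 2i, the only one missing.
extend-swap : ∀ {p q i} → Zigzag (suc p) q i → Zigzag (suc i + q) (i + suc p) i
extend-swap {p} {q} {i} (zigzag t o e s) = zigzag (stair i rest) odds↭ evens↭ sums↭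
  where
  open PermutationReasoning
  rest = alternate (i +_) (suc i +_) (i ∷ t)
  odds↭ : i ∷ evens (stair i rest) ↭ interval 0 (suc i + q)
  odds↭ = begin
    i ∷ evens (stair i rest)
      ≡⟨ cong (i ∷_) (evens-stair i rest) ⟩
    downFrom (suc i) ++ evens rest
      ≡⟨ cong (downFrom (suc i) ++_) (evens-alternate (i +_) (suc i +_) (i ∷ t)) ⟩
    downFrom (suc i) ++ map (suc i +_) (evens (i ∷ t))
      ↭⟨ downFrom-++-shift (suc i) e ⟩
    interval 0 (suc i + q) ∎
  evens↭ : odds (stair i rest) ↭ interval 0 (i + suc p)
  evens↭ = begin
    odds (stair i rest)
      ≡⟨ odds-stair i rest ⟩
    downFrom i ++ odds rest
      ≡⟨ cong (downFrom i ++_) (odds-alternate (i +_) (suc i +_) (i ∷ t)) ⟩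
    downFrom i ++ map (i +_) (odds (i ∷ t))
      ↭⟨ downFrom-++-shift i o ⟩
    interval 0 (i + suc p) ∎
  arith : ∀ i p q → suc (i + i) + (p + q) ≡ i + q + (i + suc p)
  arith = solve-∀
  sums↭ : sums (i ∷ stair i rest) ↭ interval 0 (i + q + (i + suc p))
  sums↭ = begin
    sums (i ∷ stair i rest)
      ≡⟨ sums-stair i _ _ ⟩
    downFrom (i + i) ++ i + i ∷ sums rest
      ↭⟨ shift (i + i) (downFrom (i + i)) (sums rest) ⟩
    downFrom (suc (i + i)) ++ sums rest
      ≡⟨ cong (downFrom (suc (i + i)) ++_) (sums-alternate-+ i (suc i) (i ∷ t)) ⟩
    downFrom (suc (i + i)) ++ map (i + suc i +_) (sums (i ∷ t))
      ≡⟨ cong (λ n → downFrom (suc (i + i)) ++ map (n +_) (sums (i ∷ t))) (+-suc i i) ⟩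
    downFrom (suc (i + i)) ++ map (suc (i + i) +_) (sums (i ∷ t))
      ↭⟨ downFrom-++-shift (suc (i + i)) s ⟩
    interval 0 (suc (i + i) + (p + q))
      ≡⟨ cong (interval 0) (arith i p q) ⟩
    interval 0 (i + q + (i + suc p)) ∎

-- As in `extend-swap`, but the doubled first entry makes the prefix even in length, so low stays
-- low. Both kinds of codes move up by `suc i`, the sums by 2i + 2, and the junction supplies 2i +
-- 1.
extend : ∀ {p q i} → Zigzag (suc p) q i → Zigzag (suc i + suc p) (suc i + q) i
extend {p} {q} {i} (zigzag t o e s) = zigzag (i ∷ stair i rest) odds↭ evens↭ sums↭
  where
  open PermutationReasoning
  rest = alternate (suc i +_) (suc i +_) (i ∷ t)
  odds↭ : i ∷ odds (stair i rest) ↭ interval 0 (suc i + suc p)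
  odds↭ = begin
    i ∷ odds (stair i rest)
      ≡⟨ cong (i ∷_) (odds-stair i rest) ⟩
    downFrom (suc i) ++ odds rest
      ≡⟨ cong (downFrom (suc i) ++_) (odds-alternate (suc i +_) (suc i +_) (i ∷ t)) ⟩
    downFrom (suc i) ++ map (suc i +_) (odds (i ∷ t))
      ↭⟨ downFrom-++-shift (suc i) o ⟩
    interval 0 (suc i + suc p) ∎
  evens↭ : i ∷ evens (stair i rest) ↭ interval 0 (suc i + q)
  evens↭ = begin
    i ∷ evens (stair i rest)
      ≡⟨ cong (i ∷_) (evens-stair i rest) ⟩
    downFrom (suc i) ++ evens rest
      ≡⟨ cong (downFrom (suc i) ++_) (evens-alternate (suc i +_) (suc i +_) (i ∷ t)) ⟩
    downFrom (suc i) ++ map (suc i +_) (evens (i ∷ t))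
      ↭⟨ downFrom-++-shift (suc i) e ⟩
    interval 0 (suc i + q) ∎
  arith : ∀ i p q → suc (suc (i + i)) + (p + q) ≡ i + suc p + (suc i + q)
  arith = solve-∀
  sums↭ : i + i ∷ sums (i ∷ stair i rest) ↭ interval 0 (i + suc p + (suc i + q))
  sums↭ = begin
    i + i ∷ sums (i ∷ stair i rest)
      ≡⟨ cong (i + i ∷_) (sums-stair i _ _) ⟩
    downFrom (suc (i + i)) ++ suc (i + i) ∷ sums rest
      ↭⟨ shift (suc (i + i)) (downFrom (suc (i + i))) (sums rest) ⟩
    downFrom (suc (suc (i + i))) ++ sums rest
      ≡⟨ cong (downFrom (suc (suc (i + i))) ++_) (sums-alternate-+ (suc i) (suc i) (i ∷ t)) ⟩
    downFrom (suc (suc (i + i))) ++ map (suc i + suc i +_) (sums (i ∷ t))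
      ≡⟨ cong (λ n → downFrom (suc (suc (i + i))) ++ map (suc n +_) (sums (i ∷ t))) (+-suc i i) ⟩
    downFrom (suc (suc (i + i))) ++ map (suc (suc (i + i)) +_) (sums (i ∷ t))
      ↭⟨ downFrom-++-shift (suc (suc (i + i))) s ⟩
    interval 0 (suc (suc (i + i)) + (p + q))
      ≡⟨ cong (interval 0) (arith i p q) ⟩
    interval 0 (i + suc p + (suc i + q)) ∎

-- By inversion it suffices to start in the lower half of the low labels; there
-- a stair from i down to 0 leaves a shorter zigzag that again starts at i. The
-- case of 2 i + 1 low and 2 i high labels has to be avoided: already with three
-- low and two high labels, no zigzag starts at 1.
even     : ∀ f p i → p ≤ f → i < p → Zigzag p p i
evenLow  : ∀ f p i → p ≤ f → i + i < p → Zigzag p p i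
odd      : ∀ f q i → q ≤ f → i ≤ q → q ≢ i + i → Zigzag (suc q) q i
oddLow   : ∀ f q i → q ≤ f → i + i < q → Zigzag (suc q) q i

even f p i p≤f i<p with i + i <? p
... | yes low = evenLow f p i p≤f low
-- `j` is the mirror image of `i` among the low labels, so it lies in the lower half.
... | no ¬low with m≤n⇒∃[o]m+o≡n i<p
...   | j , refl = subst (Zigzag _ _) (m+n∸n≡m i j)
        (invert (evenLow f (suc i + j) j p≤f (s≤s (+-monoˡ-≤ j
          (+-cancelˡ-≤ i j i (≤-trans (n≤1+n _) (≮⇒≥ ¬low)))))))

-- The fuel `f` bounds the number of high labels. Every cycle of calls among the four functions
-- passes through `evenLow`, the only one that lowers it.
evenLow zero    p i p≤f low = contradiction (≤-trans low p≤f) n≮0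
evenLow (suc f) p i p≤f low with m≤n⇒∃[o]m+o≡n (≤-trans (s≤s (m≤m+n i i)) low)
... | q , refl with q ≟ i + i
-- Removing 2i + 1 labels leaves `suc q` low and `q` high ones, which is the excluded case if q =
-- 2i. Then 2i + 2 labels are removed instead, leaving 2i of each kind; for i = 0 nothing would be
-- left, so one low and one high label are built from `single`.
...   | no q≢2i = subst (λ n → Zigzag (suc i + q) n i) (+-suc i q)
          (extend-swap (odd f q i (≤-trans (m≤n+m q i) (s≤s⁻¹ p≤f)) (+-cancelˡ-≤ i i q (s≤s⁻¹ low)) q≢2i))
evenLow (suc f) _ zero    _   _ | _ , refl | yes refl = extend-swap single
evenLow (suc f) _ (suc j) p≤f _ | _ , refl | yes refl =
  extend (even f (suc j + suc j) (suc j) (≤-trans (m≤n+m _ (suc j)) (s≤s⁻¹ p≤f)) (m<m+n (suc j) z<s))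

odd f q i q≤f i≤q q≢2i with i + i <? q | m≤n⇒∃[o]m+o≡n i≤q
... | yes low | _        = oddLow f q i q≤f low
... | no ¬low | j , refl with j <? i
-- Here `j` equals `i`, so the first label would be the middle low one, which `q≢2i` rules out.
...   | no j≮i  = contradiction (cong (i +_) (≤-antisym (+-cancelˡ-≤ i j i (≮⇒≥ ¬low)) (≮⇒≥ j≮i))) q≢2i
odd f q (suc i) q≤f i≤q q≢2i | no ¬low | j , refl | yes j<i =
  subst (Zigzag _ _) (m+n∸n≡m (suc i) j) (invert (oddLow f (suc i + j) j q≤f (+-monoˡ-< j j<i)))

oddLow f q i q≤f low with m≤n⇒∃[o]m+o≡n (≤-trans (m≤m+n i i) (<⇒≤ low))
... | zero  , refl = contradiction (+-monoʳ-≤ i z≤n) (<⇒≱ low)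
... | suc p , refl = extend-swap (even f (suc p) i (≤-trans (m≤n+m (suc p) i) q≤f) (+-cancelˡ-< i i (suc p) low))

-- Graceful labellings of paths with a prescribed first label

record Graceful (n i : ℕ) : Set where
  constructor graceful
  field
    tail    : List ℕ
    labels↭ : i ∷ tail ↭ interval 0 n
    diffs↭  : diffs (i ∷ tail) ↭ interval 1 (pred n)

-- The high code `b` stands for `N ∸ b`, so these labels fill the range above the low ones. The sums
-- 0, ..., N-1 become the differences N, ..., 1.
decode : ∀ {p q i} → Zigzag (suc p) q i → Graceful (suc p + q) i
decode {p} {q} {i} (zigzag t o e s) = graceful (alternate (N ∸_) id t)
  (begin
    alternate id (N ∸_) (i ∷ t)
      ↭⟨ alternate-↭ id (N ∸_) (i ∷ t) ⟩
    map id (odds (i ∷ t)) ++ map (N ∸_) (evens (i ∷ t))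
      ≡⟨ cong (_++ map (N ∸_) (evens (i ∷ t))) (map-id (odds (i ∷ t))) ⟩
    odds (i ∷ t) ++ map (N ∸_) (evens (i ∷ t))
      ↭⟨ ++⁺ o (↭-trans (map⁺ (N ∸_) e) (reflect-interval 0 q (suc p) (+-comm q (suc p)))) ⟩
    interval 0 (suc p) ++ interval (suc p) q
      ≡⟨ interval-++ (suc p) q refl ⟩
    interval 0 (suc p + q) ∎)
  (begin
    diffs (alternate id (N ∸_) (i ∷ t))
      ≡⟨ diffs-alternate-∸ N (i ∷ t) (All.map (λ b<q → ≤-trans (<⇒≤ b<q) (m≤n+m q p)) (below e)) ⟩
    map ∣ N -_∣ (sums (i ∷ t))
      ≡⟨ map-cong-All (λ s<N → m≤n⇒∣n-m∣≡n∸m (<⇒≤ s<N)) (below s) ⟩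
    map (N ∸_) (sums (i ∷ t))
      ↭⟨ map⁺ (N ∸_) s ⟩
    map (N ∸_) (interval 0 N)
      ↭⟨ reflect-interval 0 N 1 (+-comm N 1) ⟩
    interval 1 N ∎)
  where
  open PermutationReasoning
  N = p + q

complement : ∀ {N i} → Graceful (suc N) i → Graceful (suc N) (N ∸ i)
complement {N} {i} (graceful t l d) = graceful (map (N ∸_) t) (reflect-all l)
  (↭-trans (↭-reflexive (trans (consec-map {h = id} ∣∸-∸∣ (below-suc l)) (map-id (diffs (i ∷ t))))) d)

beyond-interval : ∀ N n → map ∣ N -_∣ (interval (suc N) n) ≡ interval 1 n
beyond-interval N n = begin
  map ∣ N -_∣ (interval (suc N) n)
    ≡⟨ cong (λ a → map ∣ N -_∣ (interval a n)) (+-comm 1 N) ⟩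
  map ∣ N -_∣ (interval (N + 1) n)
    ≡⟨ cong (map ∣ N -_∣) (map-+-interval N 1 n) ⟨
  map ∣ N -_∣ (map (N +_) (interval 1 n))
    ≡⟨ map-∘ (interval 1 n) ⟨
  map (λ x → ∣ N - N + x ∣) (interval 1 n)
    ≡⟨ map-cong (∣m-m+n∣≡n N) (interval 1 n) ⟩
  map id (interval 1 n)
    ≡⟨ map-id (interval 1 n) ⟩
  interval 1 n ∎
  where open ≡-Reasoning

-- The one end label without a zigzag: from label L = suc l, a stair down to 0
-- is followed by a reflected zigzag on the labels strictly between the low and
-- the high labels of the stair.
middle-graceful : ∀ {l} → Zigzag (suc l) (suc l) l →
                  let L = suc l in Graceful (suc (L + L + (L + L))) L
middle-graceful {l} (zigzag t o e s) = graceful (alternate (N ∸_) id (stair L rest)) labels↭ diffs↭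
  where
  open PermutationReasoning
  L = suc l
  -- With these constants the odd positions of `rest` get the labels 2L+1, ..., 3L, and the even
  -- ones the codes 2L, ..., 3L-1 of the labels 2L, ..., L+1. Larger labels are thus at the odd
  -- positions, contrary to the stair, and the sums within `rest` exceed `N`.
  A = l + (L + L)
  B = L + (L + L)
  N = L + L + (L + L)
  rest = alternate (A ∸_) (B ∸_) (l ∷ t)
  c = L ∷ stair L rest

  odds↭ : odds c ↭ interval 0 (suc L) ++ interval (suc (L + L)) L
  odds↭ = begin
    odds c
      ≡⟨ cong (L ∷_) (evens-stair L rest) ⟩
    downFrom (suc L) ++ evens rest
      ≡⟨ cong (downFrom (suc L) ++_) (evens-alternate (A ∸_) (B ∸_) (l ∷ t)) ⟩
    downFrom (suc L) ++ map (B ∸_) (evens (l ∷ t))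
      ↭⟨ ++⁺ (downFrom-interval (suc L)) (↭-trans (map⁺ (B ∸_) e)
           (reflect-interval 0 L (suc (L + L)) (+-suc L (L + L)))) ⟩
    interval 0 (suc L) ++ interval (suc (L + L)) L ∎

  evens↭ : evens c ↭ interval 0 L ++ interval (L + L) L
  evens↭ = begin
    evens c
      ≡⟨ odds-stair L rest ⟩
    downFrom L ++ odds rest
      ≡⟨ cong (downFrom L ++_) (odds-alternate (A ∸_) (B ∸_) (l ∷ t)) ⟩
    downFrom L ++ map (A ∸_) (odds (l ∷ t))
      ↭⟨ ++⁺ (downFrom-interval L) (↭-trans (map⁺ (A ∸_) o)
           (reflect-interval 0 L (L + L) refl)) ⟩
    interval 0 L ++ interval (L + L) L ∎

  arith₁ : ∀ L → L + suc (L + (L + L)) ≡ suc (L + L + (L + L))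
  arith₁ = solve-∀
  arith₂ : ∀ L → L + L + L + suc L ≡ suc (L + L + (L + L))
  arith₂ = solve-∀
  arith₃ : ∀ L → L + L + L ≡ L + (L + L)
  arith₃ = solve-∀
  arith₄ : ∀ l L → l + L + suc (L + L + (L + L)) ≡ suc (l + (L + L) + (L + (L + L)))
  arith₄ = solve-∀
  arith₅ : ∀ l L → l + L + suc (L + L) ≡ suc l + L + (L + L)
  arith₅ = solve-∀

  labels↭ : alternate id (N ∸_) c ↭ interval 0 (suc N)
  labels↭ = begin
    alternate id (N ∸_) c
      ↭⟨ alternate-↭ id (N ∸_) c ⟩
    map id (odds c) ++ map (N ∸_) (evens c)
      ≡⟨ cong (_++ map (N ∸_) (evens c)) (map-id (odds c)) ⟩
    odds c ++ map (N ∸_) (evens c)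
      ↭⟨ ++⁺ odds↭ (map⁺ (N ∸_) evens↭) ⟩
    (i₁ ++ i₃) ++ map (N ∸_) (interval 0 L ++ interval (L + L) L)
      ≡⟨ cong ((i₁ ++ i₃) ++_) (map-++ (N ∸_) (interval 0 L) _) ⟩
    (i₁ ++ i₃) ++ map (N ∸_) (interval 0 L) ++ map (N ∸_) (interval (L + L) L)
      ↭⟨ ++⁺ˡ (i₁ ++ i₃) (++⁺ (reflect-interval 0 L (suc B) (arith₁ L))
                              (reflect-interval (L + L) L (suc L) (arith₂ L))) ⟩
    (i₁ ++ i₃) ++ i₄ ++ i₂
      ≡⟨ ++-assoc i₁ i₃ (i₄ ++ i₂) ⟩
    i₁ ++ i₃ ++ i₄ ++ i₂
      ↭⟨ ++⁺ˡ i₁ (++⁺ˡ i₃ (++-comm i₄ i₂)) ⟩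
    i₁ ++ i₃ ++ i₂ ++ i₄
      ↭⟨ ++⁺ˡ i₁ (shifts i₃ i₂) ⟩
    i₁ ++ i₂ ++ i₃ ++ i₄
      ≡⟨ cong (λ xs → i₁ ++ i₂ ++ xs) (interval-++ L L (cong suc (arith₃ L))) ⟩
    i₁ ++ i₂ ++ interval (suc (L + L)) (L + L)
      ≡⟨ cong (i₁ ++_) (interval-++ L (L + L) refl) ⟩
    i₁ ++ interval (suc L) (L + (L + L))
      ≡⟨ interval-++ (suc L) (L + (L + L)) refl ⟩
    interval 0 (suc (L + (L + (L + L))))
      ≡⟨ cong (interval 0 ∘ suc) (sym (+-assoc L L (L + L))) ⟩
    interval 0 (suc N) ∎
    where
    i₁ = interval 0 (suc L)
    i₂ = interval (suc L) L
    i₃ = interval (suc (L + L)) L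
    i₄ = interval (suc B) L

  evens≤N : All (_≤ N) (evens c)
  evens≤N = All-resp-↭ (↭-sym evens↭) (All.++⁺
    (All.map (λ x<L → ≤-trans (<⇒≤ x<L) (≤-trans (m≤m+n L L) (m≤m+n (L + L) (L + L)))) (interval-< 0 L))
    (All.map (λ x< → ≤-trans (<⇒≤ x<) (+-monoʳ-≤ (L + L) (m≤m+n L L))) (interval-< (L + L) L)))

  -- The stair and the junction, whose sum is `A ∸ l` = 2L, give the sums up to 2L, hence the
  -- differences 2L, ..., 4L. The sums beyond `N` give 1, ..., 2L-1.
  sums↭ : sums c ↭ interval 0 (suc (L + L)) ++ interval (suc N) (l + L)
  sums↭ = begin
    sums c
      ≡⟨ sums-stair L _ _ ⟩
    downFrom (L + L) ++ A ∸ l ∷ sums rest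
      ↭⟨ shift (A ∸ l) (downFrom (L + L)) (sums rest) ⟩
    A ∸ l ∷ downFrom (L + L) ++ sums rest
      ≡⟨ cong (λ x → x ∷ downFrom (L + L) ++ sums rest) (m+n∸m≡n l (L + L)) ⟩
    downFrom (suc (L + L)) ++ sums rest
      ≡⟨ cong (downFrom (suc (L + L)) ++_) (sums-alternate-∸ A B (l ∷ t)
           (All.map (λ x<L → ≤-trans (s≤s⁻¹ x<L) (m≤m+n l (L + L))) (below o))
           (All.map (λ x<L → ≤-trans (<⇒≤ x<L) (m≤m+n L (L + L))) (below e))) ⟩
    downFrom (suc (L + L)) ++ map (A + B ∸_) (sums (l ∷ t))
      ↭⟨ ++⁺ (downFrom-interval (suc (L + L))) (↭-trans (map⁺ (A + B ∸_) s)
           (reflect-interval 0 (l + L) (suc N) (arith₄ l L))) ⟩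
    interval 0 (suc (L + L)) ++ interval (suc N) (l + L) ∎

  diffs↭ : diffs (alternate id (N ∸_) c) ↭ interval 1 N
  diffs↭ = begin
    diffs (alternate id (N ∸_) c)
      ≡⟨ diffs-alternate-∸ N c evens≤N ⟩
    map ∣ N -_∣ (sums c)
      ↭⟨ map⁺ _ sums↭ ⟩
    map ∣ N -_∣ (interval 0 (suc (L + L)) ++ interval (suc N) (l + L))
      ≡⟨ map-++ ∣ N -_∣ (interval 0 (suc (L + L))) _ ⟩
    map ∣ N -_∣ (interval 0 (suc (L + L))) ++ map ∣ N -_∣ (interval (suc N) (l + L))
      ≡⟨ cong₂ _++_ (map-cong-All (λ x< → m≤n⇒∣n-m∣≡n∸m (≤-trans (s≤s⁻¹ x<) (m≤m+n (L + L) (L + L))))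
                                  (interval-< 0 (suc (L + L))))
                    (beyond-interval N (l + L)) ⟩
    map (N ∸_) (interval 0 (suc (L + L))) ++ interval 1 (l + L)
      ↭⟨ ++⁺ʳ _ (reflect-interval 0 (suc (L + L)) (L + L) refl) ⟩
    interval (L + L) (suc (L + L)) ++ interval 1 (l + L)
      ↭⟨ ++-comm (interval (L + L) (suc (L + L))) _ ⟩
    interval 1 (l + L) ++ interval (L + L) (suc (L + L))
      ≡⟨ interval-++ (l + L) (suc (L + L)) refl ⟩
    interval 1 (l + L + suc (L + L))
      ≡⟨ cong (interval 1) (arith₅ l L) ⟩
    interval 1 N ∎

data Half : ℕ → Set where
  2* : ∀ h → Half (h + h)
  1+2* : ∀ h → Half (suc (h + h))

half : ∀ n → Half n
half zero = 2* zero
half (suc n) with half n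
... | 2* h   = 1+2* h
... | 1+2* h = subst Half (cong suc (+-suc h h)) (2* (suc h))

gracefulOdd : ∀ q i → i ≤ q → Graceful (suc (q + q)) i
gracefulOdd q i i≤q with q ≟ i + i
... | no q≢2i = decode (odd q q i ≤-refl i≤q q≢2i)
gracefulOdd _ zero    _ | yes refl = decode single
gracefulOdd _ (suc l) _ | yes refl = middle-graceful (even (suc l) (suc l) l ≤-refl ≤-refl)

-- A decoded zigzag starts at a low label. First labels in the upper half are reached by
-- complementing a labelling that starts in the lower half.
gracefulFrom : ∀ n i → i < n → Graceful n i
gracefulFrom n i i<n with half n
gracefulFrom _ i i<n | 1+2* h with i ≤? h
... | yes i≤h = gracefulOdd h i i≤h
... | no i≰h  = subst (Graceful _) (m∸[m∸n]≡n (s≤s⁻¹ i<n))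
  (complement (gracefulOdd h (h + h ∸ i) (≤-trans (∸-monoʳ-≤ (h + h) (<⇒≤ (≰⇒> i≰h))) (≤-reflexive (m+n∸m≡n h h)))))
gracefulFrom _ i i<n | 2* (suc h) with i ≤? h
... | yes i≤h = decode (even _ (suc h) i ≤-refl (s≤s i≤h))
... | no i≰h  = subst (Graceful _) (m∸[m∸n]≡n (s≤s⁻¹ i<n))
  (complement (decode (even _ (suc h) (h + suc h ∸ i) ≤-refl
    (s≤s (≤-trans (∸-monoʳ-≤ (h + suc h) (≰⇒> i≰h)) (≤-reflexive (m+n∸n≡m h (suc h))))))))

-- Necessity of the divisor condition

Unique-resp-↭ : ∀ {A : Set} {xs ys : List A} → xs ↭ ys → Unique xs → Unique ys
Unique-resp-↭ p = SetoidPermutation.Unique-resp-↭ (setoid _) (↭⇒↭ₛ p)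

∈⇒↭ : ∀ {A : Set} {x : A} {ys} → x ∈ ys → ∃ λ zs → ys ↭ x ∷ zs
∈⇒↭ {x = x} x∈ys with ∈-∃++ x∈ys
... | as , bs , refl = as ++ bs , shift x as bs

Unique-⊆⇒length≤ : ∀ {A : Set} {xs ys : List A} → Unique xs → (∀ {x} → x ∈ xs → x ∈ ys) →
                   length xs ≤ length ys
Unique-⊆⇒length≤ {xs = []}     _          _ = z≤n
Unique-⊆⇒length≤ {xs = x ∷ xs} u@(_ ∷ us) sub with ∈⇒↭ (sub (here refl))
... | zs , p = subst (suc (length xs) ≤_) (sym (↭-length p)) (s≤s (Unique-⊆⇒length≤ us sub′))
  where
  sub′ : ∀ {y} → y ∈ xs → y ∈ zs
  sub′ y∈xs with ∈-resp-↭ p (sub (there y∈xs))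
  ... | here refl = contradiction y∈xs (Unique.Unique[x∷xs]⇒x∉xs u)
  ... | there y∈zs = y∈zs

-- A missed vertex could be prepended, giving `suc v` distinct elements of `Fin v`.
visits-all : ∀ {v} (H : HamPath v) i → i ∈ HamPath.verts H
visits-all {v} (hampath xs u len) i with DecMembership._∈?_ Fin._≟_ i xs
... | yes i∈xs = i∈xs
... | no i∉xs = contradiction too-long (<⇒≱ ≤-refl)
  where
  too-long : suc v ≤ v
  too-long = subst₂ _≤_ (cong suc len) (length-tabulate {n = v} id)
    (Unique-⊆⇒length≤ {ys = allFin v} (All.¬Any⇒All¬ xs i∉xs ∷ u) (λ {x} _ → ∈-allFin x))

∣difference⇒%≡ : ∀ d .{{_ : NonZero d}} x y → d ∣ ∣ x - y ∣ → x % d ≡ y % d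
∣difference⇒%≡ d x y d∣ with ≤-total x y
... | inj₁ x≤y with m≤n⇒∃[o]m+o≡n x≤y
...   | o , refl = sym (%-remove-+ʳ x (subst (d ∣_) (∣m-m+n∣≡n x o) d∣))
∣difference⇒%≡ d x y d∣ | inj₂ y≤x with m≤n⇒∃[o]m+o≡n y≤x
...   | o , refl = %-remove-+ʳ y (subst (d ∣_) (trans (∣-∣-comm (y + o) y) (∣m-m+n∣≡n y o)) d∣)

-- The length is `δ` or `v ∸ δ`, and since `d` divides `v` it divides `δ` in either case.
∣edgeLen⇒%≡ : ∀ {d v} .{{_ : NonZero d}} → d ∣ v → ∀ (x y : Fin v) →
              d ∣ edgeLen v (toℕ x) (toℕ y) → toℕ x % d ≡ toℕ y % d
∣edgeLen⇒%≡ {d} {v} d∣v x y d∣e = ∣difference⇒%≡ d (toℕ x) (toℕ y) d∣δ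
  where
  δ = ∣ toℕ x - toℕ y ∣
  δ≤v : δ ≤ v
  δ≤v = ≤-trans (∣m-n∣≤m⊔n (toℕ x) (toℕ y)) (⊔-lub (<⇒≤ (toℕ<n x)) (<⇒≤ (toℕ<n y)))
  d∣δ : d ∣ δ
  d∣δ with ⊓-sel δ (v ∸ δ)
  ... | inj₁ e≡ = subst (d ∣_) e≡ d∣e
  ... | inj₂ e≡ = ∣m+n∣m⇒∣n (subst (d ∣_) (sym (m∸n+n≡m δ≤v)) d∣v) (subst (d ∣_) e≡ d∣e)

-- An edge whose length is a multiple of d stays within a residue class, so the
-- classes visited number at most one more than the other edges.
visited-residues : ∀ {d v} .{{_ : NonZero d}} → d ∣ v → ∀ x xs → ∃ λ R →
  countMultiples d (edgeLens v (x ∷ xs)) + length R ≡ length (x ∷ xs) ×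
  All (λ y → toℕ y % d ∈ R) (x ∷ xs)
visited-residues {d} d∣v x [] = [ toℕ x % d ] , refl , here refl ∷ []
visited-residues {d} {v} d∣v x (y ∷ xs) with visited-residues d∣v y xs
... | R , count , y∈ ∷ all with d ∣? edgeLen v (toℕ x) (toℕ y)
...   | yes d∣e = R , cong suc count , subst (_∈ R) (sym (∣edgeLen⇒%≡ d∣v x y d∣e)) y∈ ∷ y∈ ∷ all
...   | no  _   = toℕ x % d ∷ R , trans (+-suc _ (length R)) (cong suc count)
                , here refl ∷ All.map there (y∈ ∷ all)

-- Each residue r < d ≤ v is met at the vertex r itself, so the list `R` of visited classes has at
-- least `d` entries.
multiples-bound : ∀ {v} (H : HamPath v) d → d ∣ v → countMultiples d (ℓ H) ≤ v ∸ d
multiples-bound (hampath [] _ _) d d∣v = z≤n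
multiples-bound {zero} (hampath (() ∷ _) _ _) d d∣v
multiples-bound {suc _} (hampath (x ∷ xs) _ _) zero d∣v = contradiction (0∣⇒≡0 d∣v) λ ()
multiples-bound {v@(suc _)} H@(hampath (x ∷ xs) _ len) d@(suc _) d∣v with visited-residues d∣v x xs
... | R , count , all = m+n≤o⇒m≤o∸n _ (subst (countMultiples d (ℓ H) + d ≤_) (trans count len)
                          (+-monoʳ-≤ (countMultiples d (ℓ H)) d≤))
  where
  residue∈R : ∀ {r} → r ∈ upTo d → r ∈ R
  residue∈R {r} r∈ = subst (_∈ R) r≡ (All.lookup all (visits-all H (fromℕ< r<v)))
    where
    r<d = ∈-upTo⁻ r∈
    r<v = ≤-trans r<d (∣⇒≤ d∣v)
    r≡ : toℕ (fromℕ< r<v) % d ≡ r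
    r≡ = trans (cong (_% d) (toℕ-fromℕ< r<v)) (m<n⇒m%n≡m r<d)
  d≤ : d ≤ length R
  d≤ = subst (_≤ length R) (length-upTo d) (Unique-⊆⇒length≤ (Unique.upTo⁺ d) residue∈R)

countMultiples-resp-↭ : ∀ d {xs ys} → xs ↭ ys → countMultiples d xs ≡ countMultiples d ys
countMultiples-resp-↭ d p = ↭-length (filter-↭ (d ∣?_) p)

-- One direction is `multiples-bound`; for the other, the given path serves as the witness.
realised⇒BHR : ∀ {v L} → (∃ λ (H : HamPath v) → ℓ H ↭ L) → BHR v L
realised⇒BHR r@(H , p) = mk⇔ (λ _ d d∣v → subst (_≤ _) (countMultiples-resp-↭ d p) (multiples-bound H d d∣v)) (λ _ → r)

-- The multiset L* as two runs

removeOne-∷-↭ : ∀ {x ys} → x ∈ ys → ys ↭ x ∷ removeOne x ys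
removeOne-∷-↭ {x} {y ∷ ys} x∈ with x ≟ y | x∈
... | yes refl | _ = ↭-refl
... | no x≢y | here x≡y = contradiction x≡y x≢y
... | no _ | there x∈ys = ↭-trans (↭-prep y (removeOne-∷-↭ x∈ys)) (↭-swap y x ↭-refl)

removeOne-↭ : ∀ {x ys zs} → ys ↭ x ∷ zs → removeOne x ys ↭ zs
removeOne-↭ p = drop-∷ (↭-trans (↭-sym (removeOne-∷-↭ (∈-resp-↭ (↭-sym p) (here refl)))) p)

-- The function mapped over [1 .. v / 2] in Lstar is local to Defs; unification
-- recovers it.
mapped : ∀ {f : ℕ → List ℕ} {xs ys} → concatMap f xs ≡ ys → ℕ → List ℕ
mapped {f} _ = f

copies : ℕ → ℕ → List ℕ
copies v = mapped {xs = map suc (upTo (v / 2))} {ys = Lstar v} refl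

copies-twice : ∀ {v i} → 2 * i ≢ v → copies v i ≡ i ∷ i ∷ []
copies-twice {v} {i} ne with 2 * i ≟ v
... | yes e = contradiction e ne
... | no  _ = refl

copies-once : ∀ {v i} → 2 * i ≡ v → copies v i ≡ i ∷ []
copies-once {v} {i} e with 2 * i ≟ v
... | yes _ = refl
... | no ne = contradiction e ne

concatMap-twice : ∀ {f : ℕ → List ℕ} {P : ℕ → Set} → (∀ {i} → P i → f i ≡ i ∷ i ∷ []) →
                  ∀ {xs} → All P xs → concatMap f xs ↭ xs ++ xs
concatMap-twice tw [] = ↭-refl
concatMap-twice {f} tw {x ∷ xs} (p ∷ ps) = begin
  f x ++ concatMap f xs      ≡⟨ cong (_++ concatMap f xs) (tw p) ⟩
  x ∷ x ∷ concatMap f xs     ↭⟨ ↭-prep x (↭-prep x (concatMap-twice tw ps)) ⟩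
  x ∷ x ∷ xs ++ xs           ↭⟨ ↭-prep x (shift x xs xs) ⟨
  x ∷ xs ++ x ∷ xs           ∎
  where open PermutationReasoning

applyUpTo-interval : ∀ {f a} n → (∀ i → f i ≡ a + i) → applyUpTo f n ≡ interval a n
applyUpTo-interval zero    eq = refl
applyUpTo-interval {a = a} (suc n) eq =
  cong₂ _∷_ (trans (eq 0) (+-identityʳ a)) (applyUpTo-interval n (λ i → trans (eq (suc i)) (+-suc a i)))

Lstar-domain : ∀ v {m} → v / 2 ≡ m → map suc (upTo (v / 2)) ≡ interval 1 m
Lstar-domain v refl = trans (cong (map suc) (applyUpTo-interval _ (λ _ → refl))) (map-+-interval 1 0 _)

Lstar-odd : ∀ m → Lstar (suc (m + m)) ↭ interval 1 m ++ interval 1 m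
Lstar-odd m = begin
  concatMap (copies v) (map suc (upTo (v / 2)))
    ≡⟨ cong (concatMap (copies v)) (Lstar-domain v half≡) ⟩
  concatMap (copies v) (interval 1 m)
    ↭⟨ concatMap-twice {P = λ i → i ≤ m} (copies-twice ∘ <⇒≢ ∘ s≤s ∘ bound)
         (All.map s≤s⁻¹ (interval-< 1 m)) ⟩
  interval 1 m ++ interval 1 m ∎
  where
  open PermutationReasoning
  v = suc (m + m)
  double : ∀ m → suc (m + m) ≡ m * 2 + 1
  double = solve-∀
  half≡ : v / 2 ≡ m
  half≡ = trans (cong (_/ 2) (double m)) (trans (+-distrib-/-∣ˡ 1 (divides-refl m))
            (trans (+-identityʳ _) (m*n/n≡m m 2)))
  bound : ∀ {i} → i ≤ m → 2 * i ≤ m + m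
  bound {i} i≤m = +-mono-≤ i≤m (≤-trans (≤-reflexive (+-identityʳ i)) i≤m)

Lstar-even : ∀ m → Lstar (suc (suc m + m)) ↭ interval 1 (suc m) ++ interval 1 m
Lstar-even m = begin
  concatMap (copies v) (map suc (upTo (v / 2)))
    ≡⟨ cong (concatMap (copies v)) (Lstar-domain v half≡) ⟩
  concatMap (copies v) (interval 1 (suc m))
    ≡⟨ cong (concatMap (copies v)) snoc ⟨
  concatMap (copies v) (interval 1 m ++ suc m ∷ [])
    ≡⟨ concatMap-++ (copies v) (interval 1 m) _ ⟩
  concatMap (copies v) (interval 1 m) ++ copies v (suc m) ++ []
    ≡⟨ cong (λ xs → concatMap (copies v) (interval 1 m) ++ xs ++ []) (copies-once (2*[1+m]≡v m)) ⟩
  concatMap (copies v) (interval 1 m) ++ suc m ∷ []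
    ↭⟨ ++⁺ʳ _ (concatMap-twice {P = λ i → i ≤ m} (copies-twice ∘ <⇒≢ ∘ s≤s ∘ bound)
         (All.map s≤s⁻¹ (interval-< 1 m))) ⟩
  (interval 1 m ++ interval 1 m) ++ suc m ∷ []
    ≡⟨ ++-assoc (interval 1 m) (interval 1 m) _ ⟩
  interval 1 m ++ interval 1 m ++ suc m ∷ []
    ↭⟨ shifts (interval 1 m) (interval 1 m) ⟩
  interval 1 m ++ interval 1 m ++ suc m ∷ []
    ≡⟨ cong (interval 1 m ++_) snoc ⟩
  interval 1 m ++ interval 1 (suc m)
    ↭⟨ ++-comm (interval 1 m) _ ⟩
  interval 1 (suc m) ++ interval 1 m ∎
  where
  open PermutationReasoning
  v = suc (suc m + m)
  double : ∀ m → suc (suc m + m) ≡ suc m * 2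
  double = solve-∀
  half≡ : v / 2 ≡ suc m
  half≡ = trans (cong (_/ 2) (double m)) (m*n/n≡m (suc m) 2)
  2*[1+m]≡v : ∀ m → 2 * suc m ≡ suc (suc m + m)
  2*[1+m]≡v = solve-∀
  snoc : interval 1 m ++ suc m ∷ [] ≡ interval 1 (suc m)
  snoc = trans (interval-++ m 1 refl) (cong (interval 1) (+-comm m 1))
  bound : ∀ {i} → i ≤ m → 2 * i ≤ suc m + m
  bound {i} i≤m = +-mono-≤ (m≤n⇒m≤1+n i≤m) (≤-trans (≤-reflexive (+-identityʳ i)) i≤m)

-- Edge lengths as functions of differences

interval-≥ : ∀ a n → All (a ≤_) (interval a n)
interval-≥ a zero    = []
interval-≥ a (suc n) = ≤-refl ∷ All.map <⇒≤ (interval-≥ (suc a) n)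

-- `edgeLen v x y` unfolds to this function of `∣ x - y ∣`, so edge lengths can be read off a list
-- of differences.
cyclic : ℕ → ℕ → ℕ
cyclic v δ = δ ⊓ (v ∸ δ)

cyclic-short : ∀ {v δ} → δ + δ ≤ v → cyclic v δ ≡ δ
cyclic-short {v} {δ} h = m≤n⇒m⊓n≡m (m+n≤o⇒m≤o∸n δ h)

cyclic-long : ∀ {v δ} → v ≤ δ + δ → cyclic v δ ≡ v ∸ δ
cyclic-long {v} {δ} h = m≥n⇒m⊓n≡n (m≤n+o⇒m∸n≤o v δ h)

map-cyclic-short : ∀ {v n} → n + n ≤ v → map (cyclic v) (interval 1 n) ≡ interval 1 n
map-cyclic-short {v} {n} h = trans
  (map-cong-All (λ δ≤n → cyclic-short (≤-trans (+-mono-≤ (s≤s⁻¹ δ≤n) (s≤s⁻¹ δ≤n)) h)) (interval-< 1 n))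
  (map-id (interval 1 n))

map-cyclic-long : ∀ {v} a n → suc v ≡ a + n + 1 → v ≤ a + a → map (cyclic v) (interval a n) ↭ interval 1 n
map-cyclic-long {v} a n e h = ↭-trans
  (↭-reflexive (map-cong-All (λ a≤δ → cyclic-long (≤-trans h (+-mono-≤ a≤δ a≤δ))) (interval-≥ a n)))
  (reflect-interval a n 1 (sym e))

-- Taking `r` to be m or m-1 covers both parities of `v`. Differences up to `m` are their own
-- lengths, and the other `r` are reflected to r, ..., 1.
cyclic-Lstar : ∀ m r → r ≤ m → m ≤ suc r → let v = suc (m + r) in
  map (cyclic v) (interval 1 (m + r)) ↭ interval 1 m ++ interval 1 r
cyclic-Lstar m r r≤m m≤1+r = begin
  map (cyclic v) (interval 1 (m + r))
    ≡⟨ cong (map (cyclic v)) (interval-++ m r refl) ⟨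
  map (cyclic v) (interval 1 m ++ interval (suc m) r)
    ≡⟨ map-++ (cyclic v) (interval 1 m) _ ⟩
  map (cyclic v) (interval 1 m) ++ map (cyclic v) (interval (suc m) r)
    ≡⟨ cong (_++ map (cyclic v) (interval (suc m) r))
         (map-cyclic-short (≤-trans (+-monoʳ-≤ m m≤1+r) (≤-reflexive (+-suc m r)))) ⟩
  interval 1 m ++ map (cyclic v) (interval (suc m) r)
    ↭⟨ ++⁺ˡ (interval 1 m) (map-cyclic-long (suc m) r (+-comm 1 (suc (m + r)))
         (s≤s (+-monoʳ-≤ m (m≤n⇒m≤1+n r≤m)))) ⟩
  interval 1 m ++ interval 1 r ∎
  where
  open PermutationReasoning
  v = suc (m + r)

-- The k of the theorem is `suc k` here. The last `suc (suc k)` differences lie in the upper half,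
-- so they have the lengths `suc (suc k)`, ..., 1; the two largest are the ones to be removed from
-- L*.
cyclic-split : ∀ m r k w → m ≤ suc r → suc (suc k) ≤ m → suc (suc k) + w ≡ m + r → let v = suc (m + r) in
  map (cyclic v) (interval 1 (m + r)) ↭
  suc (suc k) ∷ suc k ∷ interval 1 k ++ map (cyclic v) (interval 1 w)
cyclic-split m r k w m≤1+r k<m e = begin
  map (cyclic v) (interval 1 (m + r))
    ≡⟨ cong (map (cyclic v) ∘ interval 1) (trans (sym e) (+-comm (suc (suc k)) w)) ⟩
  map (cyclic v) (interval 1 (w + suc (suc k)))
    ≡⟨ cong (map (cyclic v)) (interval-++ w (suc (suc k)) refl) ⟨
  map (cyclic v) (interval 1 w ++ interval (suc w) (suc (suc k)))
    ≡⟨ map-++ (cyclic v) (interval 1 w) _ ⟩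
  map (cyclic v) (interval 1 w) ++ map (cyclic v) (interval (suc w) (suc (suc k)))
    ↭⟨ ++⁺ˡ _ (map-cyclic-long (suc w) (suc (suc k)) (arith₁ w k e) long) ⟩
  map (cyclic v) (interval 1 w) ++ interval 1 (suc (suc k))
    ↭⟨ ++-comm (map (cyclic v) (interval 1 w)) _ ⟩
  interval 1 (suc (suc k)) ++ map (cyclic v) (interval 1 w)
    ↭⟨ ++⁺ʳ _ (↭-trans (↭-sym (∷-interval 1 (suc k))) (↭-prep _ (↭-sym (∷-interval 1 k)))) ⟩
  suc (suc k) ∷ suc k ∷ interval 1 k ++ map (cyclic v) (interval 1 w) ∎
  where
  open PermutationReasoning
  v = suc (m + r)
  arith₁ : ∀ w k → suc (suc k) + w ≡ m + r → suc v ≡ suc w + suc (suc k) + 1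
  arith₁ w k e = trans (cong (suc ∘ suc) (sym e)) (rearrange w k)
    where
    rearrange : ∀ w k → suc (suc (suc (suc k) + w)) ≡ suc w + suc (suc k) + 1
    rearrange = solve-∀
  r≤w : r ≤ w
  r≤w = +-cancelˡ-≤ m r w (≤-trans (≤-reflexive (sym e)) (+-monoˡ-≤ w k<m))
  long : v ≤ suc w + suc w
  long = s≤s (≤-trans (+-mono-≤ m≤1+r ≤-refl) (≤-trans (≤-reflexive (+-comm (suc r) r)) (+-mono-≤ r≤w (s≤s r≤w))))

-- Joining two labelled paths at the vertex 0

-- The joined list is read from `y` outwards in both directions, which costs only the symmetry of
-- the operation.
consec-ʳ++ : ∀ {_∙_ : ℕ → ℕ → ℕ} → (∀ x y → x ∙ y ≡ y ∙ x) → ∀ xs y ys →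
  consec _∙_ (xs ʳ++ y ∷ ys) ↭ consec _∙_ (y ∷ xs) ++ consec _∙_ (y ∷ ys)
consec-ʳ++ comm []       y ys = ↭-refl
consec-ʳ++ {_∙_} comm (x ∷ xs) y ys = begin
  consec _∙_ (xs ʳ++ x ∷ y ∷ ys)
    ↭⟨ consec-ʳ++ comm xs x (y ∷ ys) ⟩
  consec _∙_ (x ∷ xs) ++ x ∙ y ∷ consec _∙_ (y ∷ ys)
    ↭⟨ shift (x ∙ y) (consec _∙_ (x ∷ xs)) _ ⟩
  x ∙ y ∷ consec _∙_ (x ∷ xs) ++ consec _∙_ (y ∷ ys)
    ≡⟨ cong (λ e → e ∷ consec _∙_ (x ∷ xs) ++ consec _∙_ (y ∷ ys)) (comm x y) ⟩
  y ∙ x ∷ consec _∙_ (x ∷ xs) ++ consec _∙_ (y ∷ ys) ∎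
  where open PermutationReasoning

edgeLen-comm : ∀ v x y → edgeLen v x y ≡ edgeLen v y x
edgeLen-comm v x y = cong (cyclic v) (∣-∣-comm x y)

fins : ∀ {v xs} → All (_< v) xs → ∃ λ (is : List (Fin v)) → map toℕ is ≡ xs
fins [] = [] , refl
fins (x<v ∷ xs<v) with fins xs<v
... | is , refl = fromℕ< x<v ∷ is , cong (_∷ map toℕ is) (toℕ-fromℕ< x<v)

edgeLens-consec : ∀ v (is : List (Fin v)) → edgeLens v is ≡ consec (edgeLen v) (map toℕ is)
edgeLens-consec v []           = refl
edgeLens-consec v (i ∷ [])     = refl
edgeLens-consec v (i ∷ j ∷ is) = cong (edgeLen v (toℕ i) (toℕ j) ∷_) (edgeLens-consec v (j ∷ is))

hamPath : ∀ {v xs} → xs ↭ interval 0 v → ∃ λ (H : HamPath v) → ℓ H ≡ consec (edgeLen v) xs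
hamPath {v} {xs} p with fins (below p)
... | is , refl = hampath is (Unique.map⁻ unique) len , edgeLens-consec v is
  where
  upTo≡ : upTo v ≡ interval 0 v
  upTo≡ = applyUpTo-interval v (λ _ → refl)
  unique : Unique (map toℕ is)
  unique = Unique-resp-↭ (↭-sym p) (subst Unique upTo≡ (Unique.upTo⁺ v))
  len : length is ≡ v
  len = trans (sym (length-map toℕ is)) (trans (↭-length p) (trans (cong length (sym upTo≡)) (length-upTo v)))

edgeLens-diffs : ∀ v xs → consec (edgeLen v) (map suc xs) ≡ map (cyclic v) (diffs xs)
edgeLens-diffs v xs = consec-map {P = λ _ → ⊤} (λ _ _ → refl) (All.universal _ xs)

joined : ∀ m r k w a b → m ≤ suc r → suc (suc k) ≤ m → suc (suc k) + w ≡ m + r → a ≤ k → suc b ≤ m →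
  ∃ λ (H : HamPath (suc (m + r))) →
    ℓ H ↭ suc a ∷ suc b ∷ interval 1 k ++ map (cyclic (suc (m + r))) (interval 1 w)
joined m r k w a b m≤1+r k<m e a≤k b<m =
  proj₁ H , ↭-trans (↭-reflexive (proj₂ H)) edges↭
  where
  open PermutationReasoning
  V = m + r
  v = suc V
  r≤w : r ≤ w
  r≤w = +-cancelˡ-≤ m r w (≤-trans (≤-reflexive (sym e)) (+-monoˡ-≤ w k<m))
  -- The second path has `suc w` vertices. From k + 2 ≤ m comes r ≤ w, hence b < m ≤ r + 1 ≤ w + 1,
  -- so `b` is one of its labels.
  b<1+w : b < suc w
  b<1+w = ≤-trans b<m (≤-trans m≤1+r (s≤s r≤w))
  open Graceful (gracefulFrom (suc k) a (s≤s a≤k)) renaming (tail to t; labels↭ to labelsA; diffs↭ to diffsA)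
  open Graceful (gracefulFrom (suc w) b b<1+w) renaming (tail to u; labels↭ to labelsB; diffs↭ to diffsB)
  -- Reversing the first path puts its start `suc a` = z₁ next to 0. On the other side `V ∸ b` is v
  -- - z₂, as `b` is z₂ - 1.
  path = map suc (a ∷ t) ʳ++ 0 ∷ map (V ∸_) (b ∷ u)

  e′ : suc w + suc (suc k) ≡ suc V
  e′ = cong suc (trans (+-comm w (suc (suc k))) e)

  path↭ : path ↭ interval 0 v
  path↭ = begin
    path
      ↭⟨ ++↭ʳ++ (map suc (a ∷ t)) _ ⟨
    map suc (a ∷ t) ++ 0 ∷ map (V ∸_) (b ∷ u)
      ↭⟨ shift 0 (map suc (a ∷ t)) _ ⟩
    0 ∷ map suc (a ∷ t) ++ map (V ∸_) (b ∷ u)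
      ↭⟨ ↭-prep 0 (++⁺ (map⁺ suc labelsA) (↭-trans (map⁺ (V ∸_) labelsB)
           (reflect-interval 0 (suc w) (suc (suc k)) e′))) ⟩
    0 ∷ map suc (interval 0 (suc k)) ++ interval (suc (suc k)) (suc w)
      ≡⟨ cong (λ xs → 0 ∷ xs ++ interval (suc (suc k)) (suc w)) (map-+-interval 1 0 (suc k)) ⟩
    0 ∷ interval 1 (suc k) ++ interval (suc (suc k)) (suc w)
      ≡⟨ cong (0 ∷_) (interval-++ (suc k) (suc w) refl) ⟩
    0 ∷ interval 1 (suc k + suc w)
      ≡⟨ cong (λ n → 0 ∷ interval 1 n) (trans (+-suc (suc k) w) e) ⟩
    interval 0 v ∎

  H = hamPath path↭

  m+m≤v : m + m ≤ v
  m+m≤v = ≤-trans (+-monoʳ-≤ m m≤1+r) (≤-reflexive (+-suc m r))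

  a-edge : edgeLen v 0 (suc a) ≡ suc a
  a-edge = cyclic-short (≤-trans (+-mono-≤ a<m a<m) m+m≤v)
    where
    a<m : suc a ≤ m
    a<m = ≤-trans (s≤s a≤k) (<⇒≤ k<m)

  b-edge : edgeLen v 0 (V ∸ b) ≡ suc b
  b-edge = trans (cyclic-long long) (trans (cong (_∸ (V ∸ b)) (sym split)) (m+n∸m≡n (V ∸ b) (suc b)))
    where
    b≤V : b ≤ V
    b≤V = ≤-trans (<⇒≤ b<m) (m≤m+n m r)
    split : V ∸ b + suc b ≡ v
    split = trans (+-suc (V ∸ b) b) (cong suc (m∸n+n≡m b≤V))
    1+b≤ : suc b ≤ V ∸ b
    1+b≤ = m+n≤o⇒m≤o∸n (suc b) (s≤s⁻¹
      (≤-trans (≤-reflexive (cong suc (sym (+-suc b b)))) (≤-trans (+-mono-≤ b<m b<m) m+m≤v)))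
    long : v ≤ (V ∸ b) + (V ∸ b)
    long = ≤-trans (≤-reflexive (sym split)) (+-monoʳ-≤ (V ∸ b) 1+b≤)

  u≤ : All (_≤ V) (b ∷ u)
  u≤ = All.map (λ x≤w → ≤-trans x≤w (≤-trans (m≤n+m w (suc (suc k))) (≤-reflexive e))) (below-suc labelsB)

  edges↭ : consec (edgeLen v) path ↭ suc a ∷ suc b ∷ interval 1 k ++ map (cyclic v) (interval 1 w)
  edges↭ = begin
    consec (edgeLen v) path
      ↭⟨ consec-ʳ++ (edgeLen-comm v) (map suc (a ∷ t)) 0 _ ⟩
    (edgeLen v 0 (suc a) ∷ consec (edgeLen v) (map suc (a ∷ t))) ++
    (edgeLen v 0 (V ∸ b) ∷ consec (edgeLen v) (map (V ∸_) (b ∷ u)))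
      ≡⟨ cong₂ (λ xs ys → (edgeLen v 0 (suc a) ∷ xs) ++ (edgeLen v 0 (V ∸ b) ∷ ys))
           (edgeLens-diffs v (a ∷ t)) (consec-map {P = _≤ V} (λ x≤V y≤V → cong (cyclic v) (∣∸-∸∣ x≤V y≤V)) u≤) ⟩
    (edgeLen v 0 (suc a) ∷ map (cyclic v) (diffs (a ∷ t))) ++
    (edgeLen v 0 (V ∸ b) ∷ map (cyclic v) (diffs (b ∷ u)))
      ≡⟨ cong₂ (λ x y → (x ∷ map (cyclic v) (diffs (a ∷ t))) ++ (y ∷ map (cyclic v) (diffs (b ∷ u)))) a-edge b-edge ⟩
    suc a ∷ map (cyclic v) (diffs (a ∷ t)) ++ suc b ∷ map (cyclic v) (diffs (b ∷ u))
      ↭⟨ ↭-prep (suc a) (shift (suc b) (map (cyclic v) (diffs (a ∷ t))) _) ⟩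
    suc a ∷ suc b ∷ map (cyclic v) (diffs (a ∷ t)) ++ map (cyclic v) (diffs (b ∷ u))
      ↭⟨ ↭-prep (suc a) (↭-prep (suc b) (++⁺ (map⁺ (cyclic v) diffsA) (map⁺ (cyclic v) diffsB))) ⟩
    suc a ∷ suc b ∷ map (cyclic v) (interval 1 k) ++ map (cyclic v) (interval 1 w)
      ≡⟨ cong (λ xs → suc a ∷ suc b ∷ xs ++ map (cyclic v) (interval 1 w))
           (map-cyclic-short (≤-trans (+-mono-≤ k≤m k≤m) m+m≤v)) ⟩
    suc a ∷ suc b ∷ interval 1 k ++ map (cyclic v) (interval 1 w) ∎
    where
    k≤m : k ≤ m
    k≤m = ≤-trans (n≤1+n k) (<⇒≤ k<m)

-- By `cyclic-split`, removing `suc (suc k)` and then `suc k` from L* leaves exactly the edge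
-- lengths found by `joined` inside the two paths. The part `map (cyclic v) (interval 1 w)` occurs
-- on both sides and is matched unevaluated.
realisation : ∀ m r k a b → r ≤ m → m ≤ suc r → suc (suc k) ≤ m → a ≤ k → suc b ≤ m →
  let v = suc (m + r) in Lstar v ↭ interval 1 m ++ interval 1 r →
  ∃ λ (H : HamPath v) → ℓ H ↭ Lk v (suc k) (suc a) (suc b)
realisation m r k a b r≤m m≤1+r k<m a≤k b<m L↭ with m≤n⇒∃[o]m+o≡n (≤-trans k<m (m≤m+n m r))
... | w , e with joined m r k w a b m≤1+r k<m e a≤k b<m
...   | H , p = H , ↭-trans p (↭-prep _ (↭-prep _ (↭-sym (removeOne-↭ (removeOne-↭
          (↭-trans L↭ (↭-trans (↭-sym (cyclic-Lstar m r r≤m m≤1+r)) (cyclic-split m r k w m≤1+r k<m e))))))))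

realisable : (v m k z₁ z₂ : ℕ) → (v ≡ 2 * m ⊎ v ≡ 2 * m + 1) →
             1 ≤ k → k < m → 1 ≤ z₁ → z₁ ≤ k → 1 ≤ z₂ → z₂ ≤ m →
             ∃ λ (H : HamPath v) → ℓ H ↭ Lk v k z₁ z₂
realisable v (suc m) (suc k) (suc a) (suc b) (inj₁ v≡) _ k<m _ a≤k _ b≤m =
  subst (λ v → ∃ λ (H : HamPath v) → ℓ H ↭ Lk v (suc k) (suc a) (suc b)) (trans (arith m) (sym v≡))
    (realisation (suc m) m k a b (n≤1+n m) ≤-refl k<m (s≤s⁻¹ a≤k) b≤m (Lstar-even m))
  where
  arith : ∀ m → suc (suc m + m) ≡ 2 * suc m
  arith = solve-∀
realisable v m (suc k) (suc a) (suc b) (inj₂ v≡) _ k<m _ a≤k _ b≤m =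
  subst (λ v → ∃ λ (H : HamPath v) → ℓ H ↭ Lk v (suc k) (suc a) (suc b)) (trans (arith m) (sym v≡))
    (realisation m m k a b ≤-refl (n≤1+n m) k<m (s≤s⁻¹ a≤k) b≤m (Lstar-odd m))
  where
  arith : ∀ m → suc (m + m) ≡ 2 * m + 1
  arith = solve-∀

theorem6p2 : (v m k z₁ z₂ : ℕ) → (v ≡ 2 * m ⊎ v ≡ 2 * m + 1) → 2 ≤ m →
    1 ≤ k → k < m → 1 ≤ z₁ → z₁ ≤ k → 1 ≤ z₂ → z₂ ≤ m →
    BHR v (Lk v k z₁ z₂) × (∃ λ (H : HamPath v) → ℓ H ↭ Lk v k z₁ z₂)
theorem6p2 v m k z₁ z₂ v≡ _ 1≤k k<m 1≤z₁ z₁≤k 1≤z₂ z₂≤m = realised⇒BHR path , path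
  where
  path = realisable v m k z₁ z₂ v≡ 1≤k k<m 1≤z₁ z₁≤k 1≤z₂ z₂≤m
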